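{- Let $k \ge 2$ be an integer. There exist $k$ distinct positive integers $c_1,\dots,c_k$, an infinite set $\mathcal{N}$ of positive integers, and for each $N \in \mathcal{N}$ a set $A_N \subset \mathbb{Z}_N = \mathbb{Z}/N\mathbb{Z}$ such that \[ |A_N| \geq \frac{N^{1/2}}{k}\,(1 - o(1)) \qquad (N \to \infty,\ N \in \mathcal{N}), \] and such that for each $N\in\mathcal N$ and each pair $1 \leq i \leq j \leq k$, the equation $c_i(x_1 - x_2) = c_j(x_3 - x_4)$ in $\mathbb{Z}_N$ has only trivial solutions with $x_1,x_2,x_3,x_4 \in A_N$.
   Context: A solution $(x_1,x_2,x_3,x_4)$ of $c_i(x_1 - x_2) = c_j(x_3 - x_4)$ is called trivial if either $x_1 = x_2$ and $x_3 = x_4$, or $i = j$ and $x_1 = x_3$, $x_2 = x_4$. -}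

module Defs where

open import Data.Nat using (ℕ; zero; suc; _*_; _≤_; _∸_)
open import Data.Integer as ℤ using (ℤ; +_)
open import Data.Integer.Divisibility using () renaming (_∣_ to _∣ℤ_)
open import Data.Fin using (Fin; toℕ)
open import Data.Fin.Subset using (Subset; _∈_; ∣_∣)
open import Data.Product using (_×_; ∃-syntax)
open import Data.Sum using (_⊎_)
open import Relation.Binary.PropositionalEquality using (_≡_)

EqMod : (N c c' : ℕ) → (x₁ x₂ x₃ x₄ : Fin N) → Set
EqMod N c c' x₁ x₂ x₃ x₄ =
  (+ N) ∣ℤ ((+ c ℤ.* (+ toℕ x₁ ℤ.- + toℕ x₂)) ℤ.- (+ c' ℤ.* (+ toℕ x₃ ℤ.- + toℕ x₄)))

Trivial : {k N : ℕ} → (i j : Fin k) → (x₁ x₂ x₃ x₄ : Fin N) → Set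
Trivial i j x₁ x₂ x₃ x₄ = (x₁ ≡ x₂ × x₃ ≡ x₄) ⊎ (i ≡ j × x₁ ≡ x₃ × x₂ ≡ x₄)

OnlyTrivial : {k : ℕ} → (c : Fin k → ℕ) → (N : ℕ) → Subset N → (i j : Fin k) → Set
OnlyTrivial c N A i j = ∀ x₁ x₂ x₃ x₄ → x₁ ∈ A → x₂ ∈ A → x₃ ∈ A → x₄ ∈ A →
  EqMod N (c i) (c j) x₁ x₂ x₃ x₄ → Trivial i j x₁ x₂ x₃ x₄

Infinite : (ℕ → Set) → Set
Infinite P = ∀ M → ∃[ N ] (M ≤ N × P N)

-- |A_N| ≥ (N^{1/2}/k)(1 - o(1)) as N → ∞ in 𝒩:
-- for every m ≥ 1 (ε = 1/m), for all sufficiently large N ∈ 𝒩,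
-- |A_N| ≥ (1 - 1/m) N^{1/2} / k, i.e.  (m-1)² N ≤ k² m² |A_N|².
LowerBound : (k : ℕ) → (𝒩 : ℕ → Set) → (A : (N : ℕ) → Subset N) → Set
LowerBound k 𝒩 A = ∀ m → 1 ≤ m → ∃[ M ] ∀ N → M ≤ N → 𝒩 N →
  (m ∸ 1) * (m ∸ 1) * N ≤ k * k * (m * m) * (∣ A N ∣ * ∣ A N ∣)

{-# OPTIONS --safe #-}

-- Take cᵢ = 2ⁱ.  Let F be a field with q = 2^(2^n) elements and E = F(θ), θ² = θ + c, a quadratic
-- extension with cyclic unit group generated by g.  The logarithms of the elements θ + x (x ∈ F)
-- form a Sidon set in ℤ/(q² - 1): a product (θ + x)(θ + y) determines x + y and x y (Bose).  As
-- (θ + x)² = θ + φ x with φ x = x² + c, doubling permutes this set, so for i < j a nontrivial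
-- solution of 2ⁱ(x₁ - x₂) = 2ʲ(x₃ - x₄) puts x₁ and x₃ less than k steps apart on an orbit of φ.
-- It therefore suffices to keep every k-th point of every orbit, and this keeps a proportion
-- 1/k - o(1) because all the orbits have 2^(n+1) points.
--
-- The fields form a tower with c ↦ c θ at each step.  The first coordinate of F(θ) = F θ ⊕ F
-- carries the new φ to the old one, which gives the orbit lengths and representatives inductively.

module Submission where

open import Defs
open import Algebra.Bundles using (CommutativeRing; CommutativeSemiring; RawRing)
import Algebra.Properties.CommutativeSemiring.Exp
import Algebra.Solver.Ring
open import Algebra.Solver.Ring.AlmostCommutativeRing using (AlmostCommutativeRing; _-Raw-AlmostCommutative⟶_)
open import Algebra.Structures using (IsCommutativeSemiring)
open import Algebra.Structures.Biased using (isCommutativeMonoidˡ; isCommutativeSemiringˡ)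
open import Data.Bool using (Bool; true; false; _xor_; _∧_; if_then_else_)
import Data.Bool.Properties as Bool
open import Data.Fin as Fin using (Fin; toℕ; fromℕ<; remQuot) renaming (_≤_ to _≤ᶠ_)
import Data.Fin.Properties as Fin
open import Data.Fin.Subset using (Subset; _∈_; ∣_∣; _-_; ⊥)
open import Data.Fin.Subset.Properties using (x∈p⇒∣p-x∣<∣p∣; x∈p∧x≢y⇒x∈p-y)
open import Data.Integer as ℤ using (_⊖_)
import Data.Integer.Properties as ℤ
import Data.Integer.Solver as ℤ-Solver
open import Data.List using ([]; _∷_; length)
open import Data.List.Properties using (length-tabulate)
open import Data.List.Relation.Unary.All as All using (All; []; _∷_)
import Data.List.Relation.Unary.All.Properties as All
open import Data.List.Relation.Unary.AllPairs using ([]; _∷_)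
open import Data.List.Relation.Unary.Unique.Propositional using (Unique)
import Data.List.Relation.Unary.Unique.Propositional.Properties as Unique
open import Data.Maybe using (Maybe; just; nothing)
open import Data.Nat as ℕ using (ℕ; zero; suc; _≤_; _<_; _∸_; z≤n; s≤s; NonZero; nonTrivial⇒n>1)
import Data.Nat.Properties as ℕ
open import Data.Nat.Coprimality as Coprimality using (Coprime; coprime-divisor)
open import Data.Nat.Divisibility using (_∣_; _∤_; divides; divides-refl; _∣?_; 1∣_; ∣1⇒≡1; ∣-trans; ∣⇒≤; m∣m*n; n∣m*n; ∣n⇒∣m*n; *-monoʳ-∣; *-cancelˡ-∣; m%n≡0⇒n∣m)
open import Data.Nat.DivMod using (_%_; _/_; m≡m%n+[m/n]*n; m%n<n; m%n≤n; m<n⇒m%n≡m; [m+kn]%n≡m%n; m*n%n≡0; m/n*n≤m)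
open import Data.Nat.GeneralisedArithmetic using (fold; fold-+)
open import Data.Nat.Induction using (Acc; acc; <-wellFounded)
open import Data.Nat.ListAction using (product)
open import Data.Nat.Primality using (Prime; euclidsLemma; prime⇒irreducible; prime⇒nonTrivial)
open import Data.Nat.Primality.Factorisation using (factorise)
open import Data.Nat.Solver using (module +-*-Solver)
open import Data.Product using (_×_; _,_; proj₁; proj₂; ∃-syntax; Σ-syntax)
open import Data.Product.Function.NonDependent.Propositional using (_×-↔_)
open import Data.Product.Properties using (≡-dec; ,-injectiveˡ; ,-injectiveʳ)
open import Data.Sum using (_⊎_; inj₁; inj₂; [_,_]′)
open import Data.Vec as Vec using (Vec; []; _∷_; replicate)
open import Data.Vec.Properties using (lookup⇒[]=; []=⇒lookup; lookup∘tabulate)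
open import Function using (_∘_; _↔_; Inverse; Injection; id)
open import Function.Construct.Composition using (_↔-∘_)
open import Function.Construct.Symmetry using (↔-sym)
open import Function.Definitions using (Injective)
open import Function.Properties.Inverse using (↔⇒↣)
open import Relation.Binary using (DecidableEquality; tri<; tri≈; tri>)
open import Relation.Binary.PropositionalEquality
open import Relation.Nullary using (does; yes; no; contradiction)
open import Relation.Nullary.Decidable using (dec-true; _×-dec_; _→-dec_; ¬?)
open import Relation.Unary using (Decidable)

-- Fields of characteristic 2

record Field₂ : Set₁ where
  infixl 7 _*_
  infixl 6 _+_
  field
    K : Set
    _+_ _*_ : K → K → K
    0# 1# : K
    isCommutativeSemiring : IsCommutativeSemiring _≡_ _+_ _*_ 0# 1#
    x+x≡0 : ∀ x → x + x ≡ 0#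
    _≟_ : DecidableEquality K
    1≢0 : 1# ≢ 0#
    inverse : ∀ x → x ≢ 0# → ∃[ y ] x * y ≡ 1#

  commutativeSemiring : CommutativeSemiring _ _
  commutativeSemiring = record { isCommutativeSemiring = isCommutativeSemiring }

  open IsCommutativeSemiring isCommutativeSemiring public
    using (+-comm; +-identityˡ; +-identityʳ; *-comm; *-identityˡ; *-identityʳ; zeroˡ; zeroʳ)
  open Algebra.Properties.CommutativeSemiring.Exp commutativeSemiring public
    using (_^_; ^-homo-*; ^-assocʳ; ^-distrib-*)

  -- In characteristic 2 every element is its own negative, so negation is the identity.
  almostCommutativeRing : AlmostCommutativeRing _ _
  almostCommutativeRing = record
    { -_ = id
    ; isAlmostCommutativeRing = record
      { isCommutativeSemiring = isCommutativeSemiring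
      ; -‿cong = id
      ; -‿*-distribˡ = λ _ _ → refl
      ; -‿+-comm = λ _ _ → refl
      }
    }

  private
    -- With coefficients in the field of two elements the solver cancels equal terms in pairs, so it
    -- proves identities special to characteristic 2.
    𝔽₂ : RawRing _ _
    𝔽₂ = record
      { Carrier = Bool ; _≈_ = _≡_ ; _+_ = _xor_ ; _*_ = _∧_ ; -_ = id ; 0# = false ; 1# = true }

    embed : 𝔽₂ -Raw-AlmostCommutative⟶ almostCommutativeRing
    embed = record
      { ⟦_⟧ = λ b → if b then 1# else 0#
      ; +-homo = λ { false y → sym (+-identityˡ _)
                   ; true false → sym (+-identityʳ _)
                   ; true true → sym (x+x≡0 _) }
      ; *-homo = λ { false y → sym (zeroˡ _) ; true y → sym (*-identityˡ _) }
      ; -‿homo = λ _ → refl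
      ; 0-homo = refl
      ; 1-homo = refl
      }

    coeff≟ : (a b : Bool) → Maybe ((if a then 1# else 0#) ≡ (if b then 1# else 0#))
    coeff≟ a b with a Bool.≟ b
    ... | yes a≡b = just (cong (if_then 1# else 0#) a≡b)
    ... | no _ = nothing

  open Algebra.Solver.Ring 𝔽₂ almostCommutativeRing embed coeff≟ public
    using (solve; _:=_; _:+_; _:*_; con)

  x+y≡0⇒x≡y : ∀ x y → x + y ≡ 0# → x ≡ y
  x+y≡0⇒x≡y x y x+y≡0 = trans (solve 2 (λ x y → x := (x :+ y) :+ y) refl x y)
    (trans (cong (_+ y) x+y≡0) (+-identityˡ y))

  +-cancelʳ : ∀ x y z → x + z ≡ y + z → x ≡ y
  +-cancelʳ x y z x+z≡y+z = trans (solve 2 (λ x z → x := (x :+ z) :+ z) refl x z)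
    (trans (cong (_+ z) x+z≡y+z) (solve 2 (λ y z → (y :+ z) :+ z := y) refl y z))

  x*y≡0⇒x≡0∨y≡0 : ∀ x y → x * y ≡ 0# → x ≡ 0# ⊎ y ≡ 0#
  x*y≡0⇒x≡0∨y≡0 x y x*y≡0 with x ≟ 0#
  ... | yes x≡0 = inj₁ x≡0
  ... | no x≢0 = let x⁻¹ , x*x⁻¹≡1 = inverse x x≢0 in inj₂
    (trans (sym (*-identityˡ y)) (trans (cong (_* y) (sym x*x⁻¹≡1))
    (trans (solve 3 (λ x x⁻¹ y → (x :* x⁻¹) :* y := x⁻¹ :* (x :* y)) refl x x⁻¹ y)
    (trans (cong (x⁻¹ *_) x*y≡0) (zeroʳ x⁻¹)))))

-- Cyclicity of the unit group

-- Some prime occurs more often in `product ps` than in `m`. A prime `p` of the list that divides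
-- `m` is removed from both; it then returns to the power if it is the prime found, and to the
-- cofactor `m′` otherwise.
prime-power-excess : ∀ {ps} → All Prime ps → ∀ m → .{{NonZero m}} → product ps ∤ m →
  ∃[ p ] ∃[ b ] ∃[ m′ ] Prime p × m ≡ m′ ℕ.* p ℕ.^ b × p ∤ m′ × p ℕ.^ suc b ∣ product ps
prime-power-excess [] m n∤m = contradiction (1∣ m) n∤m
prime-power-excess {p ∷ ps} (prime[p] ∷ primes) m n∤m with p ∣? m
... | no p∤m = p , 0 , m , prime[p] , sym (ℕ.*-identityʳ m) , p∤m ,
  subst (_∣ p ℕ.* product ps) (sym (ℕ.*-identityʳ p)) (m∣m*n (product ps))
... | yes (divides-refl m₁)
  with p′ , b , m′ , prime[p′] , m₁≡ , p′∤m′ , p′^∣ ← prime-power-excess primes m₁ {{ℕ.m*n≢0⇒m≢0 m₁}}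
         (λ n₁∣m₁ → n∤m (subst (p ℕ.* product ps ∣_) (ℕ.*-comm p m₁) (*-monoʳ-∣ p n₁∣m₁)))
  with p′ ℕ.≟ p
... | yes refl = p , suc b , m′ , prime[p] ,
  trans (cong (ℕ._* p) m₁≡) (trans (ℕ.*-assoc m′ (p ℕ.^ b) p) (cong (m′ ℕ.*_) (ℕ.*-comm (p ℕ.^ b) p))) ,
  p′∤m′ , *-monoʳ-∣ p p′^∣
... | no p′≢p = p′ , b , m′ ℕ.* p , prime[p′] ,
  trans (cong (ℕ._* p) m₁≡)
    (trans (ℕ.*-assoc m′ (p′ ℕ.^ b) p)
    (trans (cong (m′ ℕ.*_) (ℕ.*-comm (p′ ℕ.^ b) p)) (sym (ℕ.*-assoc m′ p (p′ ℕ.^ b))))) ,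
  (λ p′∣m′p → [ p′∤m′ , p′∤p ]′ (euclidsLemma m′ p prime[p′] p′∣m′p)) ,
  ∣n⇒∣m*n p p′^∣
  where
  p′∤p : p′ ∤ p
  p′∤p p′∣p with prime⇒irreducible prime[p] p′∣p
  ... | inj₁ refl = contradiction (nonTrivial⇒n>1 1 {{prime⇒nonTrivial prime[p′]}}) (ℕ.<-irrefl refl)
  ... | inj₂ p′≡p = p′≢p p′≡p

-- A common divisor of p^(b + 1) and `m` is coprime to `p`, since `p` does not divide `m`; hence it
-- already divides p^b.
prime^-coprime : ∀ {p m} → Prime p → p ∤ m → ∀ b → Coprime (p ℕ.^ b) m
prime^-coprime prime[p] p∤m zero (d∣1 , _) = ∣1⇒≡1 d∣1
prime^-coprime {p} {m} prime[p] p∤m (suc b) {d} (d∣p^ , d∣m) =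
  prime^-coprime prime[p] p∤m b (coprime-divisor coprime[d,p] d∣p^ , d∣m)
  where
  coprime[d,p] : Coprime d p
  coprime[d,p] (e∣d , e∣p) with prime⇒irreducible prime[p] e∣p
  ... | inj₁ e≡1 = e≡1
  ... | inj₂ refl = contradiction (∣-trans e∣d d∣m) p∤m

coprime-∣-* : ∀ {m n a} → Coprime m n → m ∣ a → n ∣ a → m ℕ.* n ∣ a
coprime-∣-* {m} {n} coprime (divides-refl r) n∣a =
  subst (m ℕ.* n ∣_) (ℕ.*-comm m r)
    (*-monoʳ-∣ m (coprime-divisor (Coprimality.sym coprime) (subst (n ∣_) (ℕ.*-comm r m) n∣a)))

-- Roots of polynomials

module Roots (F : Field₂) where
  open Field₂ F

  -- A monic polynomial of degree d is represented by its d lower coefficients, constant term first.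
  eval : ∀ {d} → Vec K d → K → K
  eval [] x = 1#
  eval (a ∷ p) x = a + x * eval p x

  -- Division by X + `r` in Horner's scheme: the coefficients of the quotient are the values at `r`
  -- of the successive tails of the polynomial.
  quot : ∀ {d} → K → Vec K (suc d) → Vec K d
  quot {zero} r (a ∷ []) = []
  quot {suc d} r (a ∷ p) = eval p r ∷ quot r p

  eval-quot : ∀ {d} r (p : Vec K (suc d)) x → eval p x + eval p r ≡ (x + r) * eval (quot r p) x
  eval-quot {zero} r (a ∷ []) x =
    solve 3 (λ a r x → (a :+ x :* con true) :+ (a :+ r :* con true) := (x :+ r) :* con true) refl a r x
  eval-quot {suc d} r (a ∷ p) x =
    trans (solve 5 (λ a r x u v → (a :+ x :* u) :+ (a :+ r :* v) := x :* (u :+ v) :+ (x :+ r) :* v)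
             refl a r x (eval p x) (eval p r))
    (trans (cong (λ w → x * w + (x + r) * eval p r) (eval-quot r p x))
    (solve 4 (λ r x v w → x :* ((x :+ r) :* w) :+ (x :+ r) :* v := (x :+ r) :* (v :+ x :* w))
             refl r x (eval p r) (eval (quot r p) x)))

  -- A root `r` splits off the factor X + `r`; without zero divisors the other roots stay roots of
  -- the quotient.
  roots≤degree : ∀ {d} (p : Vec K d) {xs} → Unique xs → All (λ x → eval p x ≡ 0#) xs → length xs ≤ d
  roots≤degree p [] [] = z≤n
  roots≤degree [] (_ ∷ _) (1≡0 ∷ _) = contradiction 1≡0 1≢0
  roots≤degree p@(_ ∷ _) {r ∷ xs} (r∉xs ∷ unique) (p[r]≡0 ∷ roots) =
    s≤s (roots≤degree (quot r p) unique (All.zipWith quot-root (r∉xs , roots)))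
    where
    quot-root : ∀ {x} → r ≢ x × eval p x ≡ 0# → eval (quot r p) x ≡ 0#
    quot-root {x} (r≢x , p[x]≡0) =
      [ (λ x+r≡0 → contradiction (sym (x+y≡0⇒x≡y x r x+r≡0)) r≢x) , id ]′
      (x*y≡0⇒x≡0∨y≡0 _ _ (trans (sym (eval-quot r p x))
        (trans (cong₂ _+_ p[x]≡0 p[r]≡0) (x+x≡0 0#))))

  eval-0s : ∀ d x → eval (replicate d 0#) x ≡ x ^ d
  eval-0s zero x = refl
  eval-0s (suc d) x = trans (+-identityˡ _) (cong (x *_) (eval-0s d x))

  roots-of-unity≤ : ∀ d → .{{NonZero d}} → ∀ {xs} → Unique xs → All (λ x → x ^ d ≡ 1#) xs → length xs ≤ d
  roots-of-unity≤ (suc d) unique roots =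
    roots≤degree (1# ∷ replicate d 0#) unique (All.map root roots)
    where
    root : ∀ {x} → x ^ suc d ≡ 1# → 1# + x * eval (replicate d 0#) x ≡ 0#
    root {x} x^≡1 = trans (cong (λ w → 1# + x * w) (eval-0s d x)) (trans (cong (1# +_) x^≡1) (x+x≡0 1#))

-- Multiplicative orders

module Orders (F : Field₂) where
  open Field₂ F

  ^≢0 : ∀ {x} → x ≢ 0# → ∀ n → x ^ n ≢ 0#
  ^≢0 x≢0 zero = 1≢0
  ^≢0 x≢0 (suc n) eq = [ x≢0 , ^≢0 x≢0 n ]′ (x*y≡0⇒x≡0∨y≡0 _ _ eq)

  1^n≡1 : ∀ n → 1# ^ n ≡ 1#
  1^n≡1 zero = refl
  1^n≡1 (suc n) = trans (*-identityˡ _) (1^n≡1 n)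

  ^-cancel : ∀ {x} → x ≢ 0# → ∀ a d → x ^ (a ℕ.+ d) ≡ x ^ a → x ^ d ≡ 1#
  ^-cancel {x} x≢0 a d eq =
    [ (λ x^a≡0 → contradiction x^a≡0 (^≢0 x≢0 a)) , x+y≡0⇒x≡y _ _ ]′ (x*y≡0⇒x≡0∨y≡0 (x ^ a) (x ^ d + 1#)
      (trans (solve 2 (λ u v → u :* (v :+ con true) := u :* v :+ u) refl (x ^ a) (x ^ d))
      (trans (cong (_+ x ^ a) (trans (sym (^-homo-* x a d)) eq)) (x+x≡0 _))))

  record HasOrder (x : K) (e : ℕ) : Set where
    field
      e≢0 : NonZero e
      x^e≡1 : x ^ e ≡ 1#
      e∣ : ∀ {a} → x ^ a ≡ 1# → e ∣ a

    ∣⇒^≡1 : ∀ {a} → e ∣ a → x ^ a ≡ 1#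
    ∣⇒^≡1 (divides-refl r) =
      trans (cong (x ^_) (ℕ.*-comm r e)) (trans (sym (^-assocʳ x e r))
        (trans (cong (_^ r) x^e≡1) (1^n≡1 r)))

    x≢0 : x ≢ 0#
    x≢0 refl = 1≢0 (trans (sym x^e≡1) (0^e e {{e≢0}}))
      where
      0^e : ∀ e → .{{NonZero e}} → 0# ^ e ≡ 0#
      0^e (suc e) = zeroˡ _

    ^-injective : ∀ {a b} → a ≤ b → x ^ a ≡ x ^ b → e ∣ b ∸ a
    ^-injective {a} {b} a≤b eq =
      e∣ (^-cancel x≢0 a (b ∸ a) (trans (cong (x ^_) (ℕ.m+[n∸m]≡n a≤b)) (sym eq)))

  open HasOrder

  order-1 : HasOrder 1# 1
  order-1 = record { e≢0 = _ ; x^e≡1 = *-identityˡ 1# ; e∣ = λ {a} _ → 1∣ a }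

  order-^ : ∀ {x} d e → HasOrder x (d ℕ.* e) → HasOrder (x ^ d) e
  order-^ {x} d e ord = record
    { e≢0 = ℕ.m*n≢0⇒n≢0 d {{e≢0 ord}}
    ; x^e≡1 = trans (^-assocʳ x d e) (x^e≡1 ord)
    ; e∣ = λ {a} eq → *-cancelˡ-∣ d {{ℕ.m*n≢0⇒m≢0 d {{e≢0 ord}}}} (e∣ ord (trans (sym (^-assocʳ x d a)) eq))
    }

  -- If (x y)^a = 1, then the n-th power removes y and leaves x^(n a) = 1, so m divides n a and,
  -- being coprime to n, divides a. The same holds with the roles exchanged.
  order-* : ∀ {x y m n} → Coprime m n → HasOrder x m → HasOrder y n → HasOrder (x * y) (m ℕ.* n)
  order-* {x} {y} {m} {n} coprime ordˣ ordʸ = record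
    { e≢0 = ℕ.m*n≢0 m n {{e≢0 ordˣ}} {{e≢0 ordʸ}}
    ; x^e≡1 = trans (^-distrib-* x y (m ℕ.* n))
        (trans (cong₂ _*_ (∣⇒^≡1 ordˣ (m∣m*n n)) (∣⇒^≡1 ordʸ (n∣m*n m))) (*-identityˡ 1#))
    ; e∣ = λ {a} eq → coprime-∣-* coprime
        (divisor ordˣ ordʸ coprime eq)
        (divisor ordʸ ordˣ (Coprimality.sym coprime) (trans (cong (_^ a) (*-comm y x)) eq))
    }
    where
    divisor : ∀ {x y m n a} → HasOrder x m → HasOrder y n → Coprime m n → (x * y) ^ a ≡ 1# → m ∣ a
    divisor {x} {y} {m} {n} {a} ordˣ ordʸ coprime eq = coprime-divisor coprime (e∣ ordˣ (begin
      x ^ (n ℕ.* a)                 ≡⟨ *-identityʳ _ ⟨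
      x ^ (n ℕ.* a) * 1#            ≡⟨ cong (x ^ (n ℕ.* a) *_) (∣⇒^≡1 ordʸ (m∣m*n a)) ⟨
      x ^ (n ℕ.* a) * y ^ (n ℕ.* a) ≡⟨ ^-distrib-* x y (n ℕ.* a) ⟨
      (x * y) ^ (n ℕ.* a)           ≡⟨ cong ((x * y) ^_) (ℕ.*-comm n a) ⟩
      (x * y) ^ (a ℕ.* n)           ≡⟨ ^-assocʳ (x * y) a n ⟨
      ((x * y) ^ a) ^ n             ≡⟨ cong (_^ n) eq ⟩
      1# ^ n                        ≡⟨ 1^n≡1 n ⟩
      1#                            ∎))
      where open ≡-Reasoning

  -- Some prime power p ^ suc b divides the order n of y while m = m′ * p ^ b with p ∤ m′;
  -- the new element is a product of one of order m′ and one of order p ^ suc b.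
  larger-order : ∀ {x y m n} → HasOrder x m → HasOrder y n → n ∤ m →
    ∃[ z ] ∃[ o ] HasOrder z o × m < o
  larger-order {x} {y} {m} {n} ordˣ ordʸ n∤m
    with record { factors = ps ; isFactorisation = refl ; factorsPrime = primes } ← factorise n {{e≢0 ordʸ}}
    with p , b , m′ , prime[p] , refl , p∤m′ , divides r n≡ ← prime-power-excess primes m {{e≢0 ordˣ}} n∤m
    = _ , _ ,
      order-* (prime^-coprime prime[p] p∤m′ (suc b))
        (order-^ r (p ℕ.^ suc b) (subst (HasOrder y) n≡ ordʸ))
        (order-^ (p ℕ.^ b) m′ (subst (HasOrder x) (ℕ.*-comm m′ (p ℕ.^ b)) ordˣ)) ,
      subst (m′ ℕ.* p ℕ.^ b <_) (ℕ.*-comm m′ (p ℕ.^ suc b))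
        (ℕ.*-monoʳ-< m′ {{m′≢0}} (ℕ.^-monoʳ-< p (nonTrivial⇒n>1 p {{prime⇒nonTrivial prime[p]}}) (ℕ.n<1+n b)))
    where
    m′≢0 = ℕ.m*n≢0⇒m≢0 m′ {{e≢0 ordˣ}}

  -- Descent to the least positive exponent `d` with x^d = 1. The remainder modulo `d` of any other
  -- such exponent is again one and is smaller than `d`, so it is 0.
  order-exists : ∀ {x} d → .{{NonZero d}} → x ^ d ≡ 1# → ∃[ e ] HasOrder x e
  order-exists {x} d = least d (<-wellFounded d)
    where
    least : ∀ d → Acc _<_ d → .{{NonZero d}} → x ^ d ≡ 1# → ∃[ e ] HasOrder x e
    least d (acc rec) x^d≡1 with Fin.any? {n = d} (λ i → (0 ℕ.<? toℕ i) ×-dec ((x ^ toℕ i) ≟ 1#))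
    ... | yes (i , 0<i , x^i≡1) = least (toℕ i) (rec (Fin.toℕ<n i)) {{ℕ.>-nonZero 0<i}} x^i≡1
    ... | no minimal = d , record { e≢0 = ℕ.≢-nonZero (ℕ.≢-nonZero⁻¹ d) ; x^e≡1 = x^d≡1 ; e∣ = d∣ }
      where
      x^% : ∀ a → x ^ a ≡ 1# → x ^ (a % d) ≡ 1#
      x^% a x^a≡1 = begin
        x ^ (a % d)                     ≡⟨ *-identityʳ _ ⟨
        x ^ (a % d) * 1#                ≡⟨ cong (x ^ (a % d) *_) (1^n≡1 (a / d)) ⟨
        x ^ (a % d) * 1# ^ (a / d)      ≡⟨ cong (λ u → x ^ (a % d) * u ^ (a / d)) x^d≡1 ⟨
        x ^ (a % d) * (x ^ d) ^ (a / d) ≡⟨ cong (x ^ (a % d) *_) (^-assocʳ x d (a / d)) ⟩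
        x ^ (a % d) * x ^ (d ℕ.* (a / d)) ≡⟨ ^-homo-* x (a % d) (d ℕ.* (a / d)) ⟨
        x ^ (a % d ℕ.+ d ℕ.* (a / d))   ≡⟨ cong (λ u → x ^ (a % d ℕ.+ u)) (ℕ.*-comm d (a / d)) ⟩
        x ^ (a % d ℕ.+ a / d ℕ.* d)     ≡⟨ cong (x ^_) (m≡m%n+[m/n]*n a d) ⟨
        x ^ a                           ≡⟨ x^a≡1 ⟩
        1#                              ∎
        where open ≡-Reasoning

      d∣ : ∀ {a} → x ^ a ≡ 1# → d ∣ a
      d∣ {a} x^a≡1 with a % d ℕ.≟ 0
      ... | yes a%d≡0 = m%n≡0⇒n∣m a d a%d≡0
      ... | no a%d≢0 = contradiction
        (fromℕ< (m%n<n a d) , subst (0 <_) (sym toℕ≡) (ℕ.n≢0⇒n>0 a%d≢0) , trans (cong (x ^_) toℕ≡) (x^% a x^a≡1))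
        minimal
        where
        toℕ≡ = Fin.toℕ-fromℕ< (m%n<n a d)

-- A generator of the unit group and discrete logarithms

module Cyclic (F : Field₂) (Q : ℕ) (K↔Fin : Field₂.K F ↔ Fin Q) where
  open Field₂ F
  open Roots F
  open Orders F
  open HasOrder
  private module I = Inverse K↔Fin

  -- Two of the Q + 1 powers x^0, ..., x^Q coincide, and the difference of their exponents is a
  -- period.
  period : ∀ {x} → x ≢ 0# → ∃[ d ] NonZero d × d ≤ Q × x ^ d ≡ 1#
  period {x} x≢0 with i , j , i<j , eq ← Fin.pigeonhole (ℕ.n<1+n Q) (λ i → I.to (x ^ toℕ i)) =
    toℕ j ∸ toℕ i , ℕ.>-nonZero (ℕ.m<n⇒0<n∸m i<j) ,
    ℕ.≤-trans (ℕ.m∸n≤m (toℕ j) (toℕ i)) (Fin.toℕ≤pred[n] j) ,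
    ^-cancel x≢0 (toℕ i) (toℕ j ∸ toℕ i)
      (trans (cong (x ^_) (ℕ.m+[n∸m]≡n (ℕ.<⇒≤ i<j))) (sym (Injection.injective (↔⇒↣ K↔Fin) eq)))

  order≤Q : ∀ {x e} → HasOrder x e → e ≤ Q
  order≤Q ord with d , d≢0 , d≤Q , x^d≡1 ← period (x≢0 ord) =
    ℕ.≤-trans (∣⇒≤ {{d≢0}} (e∣ ord x^d≡1)) d≤Q

  abstract
    -- As long as some nonzero y violates y^e = 1, its order does not divide `e` and `larger-order`
    -- supplies an element of larger order. Orders are at most `Q`, so this ends.
    exponent : ∃[ g ] ∃[ e ] HasOrder g e × (∀ y → y ≢ 0# → y ^ e ≡ 1#)
    exponent = search order-1 (<-wellFounded _)
      where
      search : ∀ {g e} → HasOrder g e → Acc _<_ (Q ∸ e) →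
        ∃[ g ] ∃[ e ] HasOrder g e × (∀ y → y ≢ 0# → y ^ e ≡ 1#)
      search {g} {e} ord (acc rec)
        with Fin.all? (λ i → ¬? (I.from i ≟ 0#) →-dec ((I.from i ^ e) ≟ 1#))
      ... | yes all = g , e , ord , λ y y≢0 →
        subst (λ y → y ^ e ≡ 1#) (I.strictlyInverseʳ y)
          (all (I.to y) (y≢0 ∘ trans (sym (I.strictlyInverseʳ y))))
      ... | no ¬all
        with i , ¬P ← Fin.¬∀⟶∃¬ Q _ (λ i → ¬? (I.from i ≟ 0#) →-dec ((I.from i ^ e) ≟ 1#)) ¬all
        with I.from i ≟ 0#
      ... | yes y≡0 = contradiction (λ y≢0 → contradiction y≡0 y≢0) ¬P
      ... | no y≢0
        with d , d≢0 , _ , y^d≡1 ← period y≢0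
        with n , ordʸ ← order-exists d {{d≢0}} y^d≡1
        with z , o , ordᶻ , e<o ← larger-order ord ordʸ (λ n∣e → ¬P (λ _ → ∣⇒^≡1 ordʸ n∣e))
        = search ordᶻ (rec (ℕ.∸-monoʳ-< e<o (order≤Q ordᶻ)))

  N : ℕ
  N = proj₁ (proj₂ exponent)

  g : K
  g = proj₁ exponent

  g-order : HasOrder g N
  g-order = proj₁ (proj₂ (proj₂ exponent))

  N≤Q : N ≤ Q
  N≤Q = order≤Q g-order

  g^-injective : {a b : Fin N} → g ^ toℕ a ≡ g ^ toℕ b → a ≡ b
  g^-injective {a} {b} eq = [ (λ a≤b → le a≤b eq) , (λ b≤a → sym (le b≤a (sym eq))) ]′ (ℕ.≤-total (toℕ a) (toℕ b))
    where
    le : {a b : Fin N} → toℕ a ≤ toℕ b → g ^ toℕ a ≡ g ^ toℕ b → a ≡ b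
    le {a} {b} a≤b eq with toℕ b ∸ toℕ a in b∸a | ^-injective g-order a≤b eq
    ... | zero | _ = Fin.toℕ-injective (ℕ.≤-antisym a≤b (ℕ.m∸n≡0⇒m≤n b∸a))
    ... | suc d | N∣ = contradiction (∣⇒≤ N∣)
      (ℕ.<⇒≱ (ℕ.≤-<-trans (ℕ.≤-reflexive (sym b∸a)) (ℕ.≤-<-trans (ℕ.m∸n≤m (toℕ b) (toℕ a)) (Fin.toℕ<n b))))

  -- The powers of `g` are `N` distinct roots of X^N + 1. A nonzero `y` is a root as well, so if it
  -- were not among them there would be N + 1 roots.
  log : ∀ y → y ≢ 0# → ∃[ a ] g ^ toℕ {N} a ≡ y
  log y y≢0 with Fin.any? (λ a → (g ^ toℕ {N} a) ≟ y)
  ... | yes found = found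
  ... | no missing = contradiction
    (roots-of-unity≤ N {{e≢0 g-order}}
      (All.tabulate⁺ (λ a eq → missing (a , sym eq)) ∷ Unique.tabulate⁺ g^-injective)
      (proj₂ (proj₂ (proj₂ exponent)) y y≢0 ∷ All.tabulate⁺ (λ a → proj₂ (proj₂ (proj₂ exponent)) _ (^≢0 (x≢0 g-order) (toℕ a)))))
    (ℕ.<⇒≱ (s≤s (ℕ.≤-reflexive (sym (length-tabulate (λ a → g ^ toℕ {N} a))))))

-- The tower of quadratic extensions

remQuot-injective : ∀ {m} n → Injective _≡_ _≡_ (remQuot {m} n)
remQuot-injective {m} n {i} {j} eq =
  trans (sym (Fin.combine-remQuot {m} n i)) (trans (cong (λ (a , b) → Fin.combine a b) eq) (Fin.combine-remQuot {m} n j))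

r*e*4h≡r*2h*2e : ∀ r e h → r ℕ.* e ℕ.* (h ℕ.+ h ℕ.+ (h ℕ.+ h)) ≡ r ℕ.* (h ℕ.+ h) ℕ.* (2 ℕ.* e)
r*e*4h≡r*2h*2e = solve 3 (λ r e h →
  r :* e :* (h :+ h :+ (h :+ h)) := r :* (h :+ h) :* (con 2 :* e)) refl
  where open +-*-Solver

2*[q*e]≡q*[2*e] : ∀ q e → 2 ℕ.* (q ℕ.* e) ≡ q ℕ.* (2 ℕ.* e)
2*[q*e]≡q*[2*e] = solve 2 (λ q e → con 2 :* (q :* e) := q :* (con 2 :* e)) refl
  where open +-*-Solver

-- The Frobenius map and its translate

module Frobenius (F : Field₂) (c : Field₂.K F) where
  open Field₂ F

  σ φ : K → K
  σ x = x * x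
  φ x = x * x + c

  -- Squaring is additive in characteristic 2, so an iterate of φ differs from that of σ by a
  -- constant.
  φ^-affine : ∀ n x → fold x φ n ≡ fold x σ n + fold 0# φ n
  φ^-affine zero x = sym (+-identityʳ x)
  φ^-affine (suc n) x = trans (cong φ (φ^-affine n x))
    (solve 3 (λ a b c → (a :+ b) :* (a :+ b) :+ c := a :* a :+ (b :* b :+ c)) refl (fold x σ n) (fold 0# φ n) c)

  φ-injective : ∀ {x y} → φ x ≡ φ y → x ≡ y
  φ-injective {x} {y} eq = x+y≡0⇒x≡y x y ([ id , id ]′ (x*y≡0⇒x≡0∨y≡0 _ _
    (trans (solve 3 (λ x y c → (x :+ y) :* (x :+ y) := (x :* x :+ c) :+ (y :* y :+ c)) refl x y c)
      (trans (cong (_+ φ y) eq) (x+x≡0 _)))))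

  φ^-injective : ∀ n {x y} → fold x φ n ≡ fold y φ n → x ≡ y
  φ^-injective zero eq = eq
  φ^-injective (suc n) eq = φ^-injective n (φ-injective eq)

-- The map φ satisfies (θ + x)² = θ + φ x in the quadratic extension by θ² = θ + c.  All its
-- orbits have h + h points; ρ lists one point of each, and κ lists one of each pair {x, x + 1}.
record Stage : Set₁ where
  field
    field₂ : Field₂
  open Field₂ field₂ public
  field
    c : K
  open Frobenius field₂ c public
  field
    X²+X≢c : ∀ x → x * x + x ≢ c
    q : ℕ
    K↔Fin : K ↔ Fin q
    h : ℕ
    σ^h≡id : ∀ x → fold x σ h ≡ x
    -- This is the sum c + c² + c⁴ + ... with `h` terms, which along the tower is the absolute trace
    -- of `c`. Its value 1 makes φ^h the translation by 1.
    φ^h[0]≡1 : fold 0# φ h ≡ 1#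
    r : ℕ
    ρ : Fin r → K
    ρ-orbits : ∀ s i j → s < h ℕ.+ h → fold (ρ i) φ s ≡ ρ j → s ≡ 0 × i ≡ j
    r*2h≡q : r ℕ.* (h ℕ.+ h) ≡ q
    e : ℕ
    κ : Fin e → K
    κ-injective : Injective _≡_ _≡_ κ
    κ+1≢κ : ∀ i j → κ i + 1# ≢ κ j
    2*e≡q : 2 ℕ.* e ≡ q

  φ^h : ∀ x → fold x φ h ≡ x + 1#
  φ^h x = trans (φ^-affine h x) (cong₂ _+_ (σ^h≡id x) φ^h[0]≡1)

  φ^2h≡id : ∀ x → fold x φ (h ℕ.+ h) ≡ x
  φ^2h≡id x = trans (fold-+ x φ h) (trans (φ^h _) (trans (cong (_+ 1#) (φ^h x))
    (solve 1 (λ x → (x :+ con true) :+ con true := x) refl x)))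

-- (a , b) stands for a θ + b, where θ² = θ + c; X² + X + c has no root, so this is a field.
module Extension (S : Stage) where
  private module S = Stage S
  open S using (K; c; solve; _:=_; _:+_; _:*_; con; 0#; 1#)

  K² : Set
  K² = K × K

  infixl 7 _*_
  infixl 6 _+_
  _+_ _*_ : K² → K² → K²
  (a , b) + (a′ , b′) = a S.+ a′ , b S.+ b′
  (a , b) * (a′ , b′) = a S.* a′ S.+ a S.* b′ S.+ b S.* a′ , b S.* b′ S.+ c S.* (a S.* a′)

  isCommutativeSemiring : IsCommutativeSemiring _≡_ _+_ _*_ (0# , 0#) (0# , 1#)
  isCommutativeSemiring = isCommutativeSemiringˡ record
    { +-isCommutativeMonoid = isCommutativeMonoidˡ record
      { isSemigroup = record
        { isMagma = record { isEquivalence = isEquivalence ; ∙-cong = cong₂ _+_ }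
        ; assoc = λ (a , b) (a′ , b′) (a″ , b″) → cong₂ _,_
            (solve 3 (λ a a′ a″ → (a :+ a′) :+ a″ := a :+ (a′ :+ a″)) refl a a′ a″)
            (solve 3 (λ a a′ a″ → (a :+ a′) :+ a″ := a :+ (a′ :+ a″)) refl b b′ b″)
        }
      ; identityˡ = λ (a , b) → cong₂ _,_ (S.+-identityˡ a) (S.+-identityˡ b)
      ; comm = λ (a , b) (a′ , b′) → cong₂ _,_ (S.+-comm a a′) (S.+-comm b b′)
      }
    ; *-isCommutativeMonoid = isCommutativeMonoidˡ record
      { isSemigroup = record
        { isMagma = record { isEquivalence = isEquivalence ; ∙-cong = cong₂ _*_ }
        ; assoc = λ (a , b) (a′ , b′) (a″ , b″) → cong₂ _,_
            (solve 7 (λ a b a′ b′ a″ b″ c →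
              (a :* a′ :+ a :* b′ :+ b :* a′) :* a″ :+ (a :* a′ :+ a :* b′ :+ b :* a′) :* b″ :+ (b :* b′ :+ c :* (a :* a′)) :* a″
              := a :* (a′ :* a″ :+ a′ :* b″ :+ b′ :* a″) :+ a :* (b′ :* b″ :+ c :* (a′ :* a″)) :+ b :* (a′ :* a″ :+ a′ :* b″ :+ b′ :* a″))
              refl a b a′ b′ a″ b″ c)
            (solve 7 (λ a b a′ b′ a″ b″ c →
              (b :* b′ :+ c :* (a :* a′)) :* b″ :+ c :* ((a :* a′ :+ a :* b′ :+ b :* a′) :* a″)
              := b :* (b′ :* b″ :+ c :* (a′ :* a″)) :+ c :* (a :* (a′ :* a″ :+ a′ :* b″ :+ b′ :* a″)))
              refl a b a′ b′ a″ b″ c)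
        }
      ; identityˡ = λ (a , b) → cong₂ _,_
          (solve 2 (λ a b → con false :* a :+ con false :* b :+ con true :* a := a) refl a b)
          (solve 3 (λ a b c → con true :* b :+ c :* (con false :* a) := b) refl a b c)
      ; comm = λ (a , b) (a′ , b′) → cong₂ _,_
          (solve 4 (λ a b a′ b′ → a :* a′ :+ a :* b′ :+ b :* a′ := a′ :* a :+ a′ :* b :+ b′ :* a) refl a b a′ b′)
          (solve 5 (λ a b a′ b′ c → b :* b′ :+ c :* (a :* a′) := b′ :* b :+ c :* (a′ :* a)) refl a b a′ b′ c)
      }
    ; distribʳ = λ (a″ , b″) (a , b) (a′ , b′) → cong₂ _,_
        (solve 6 (λ a b a′ b′ a″ b″ →
          (a :+ a′) :* a″ :+ (a :+ a′) :* b″ :+ (b :+ b′) :* a″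
          := (a :* a″ :+ a :* b″ :+ b :* a″) :+ (a′ :* a″ :+ a′ :* b″ :+ b′ :* a″))
          refl a b a′ b′ a″ b″)
        (solve 7 (λ a b a′ b′ a″ b″ c →
          (b :+ b′) :* b″ :+ c :* ((a :+ a′) :* a″)
          := (b :* b″ :+ c :* (a :* a″)) :+ (b′ :* b″ :+ c :* (a′ :* a″)))
          refl a b a′ b′ a″ b″ c)
    ; zeroˡ = λ (a , b) → cong₂ _,_
        (solve 2 (λ a b → con false :* a :+ con false :* b :+ con false :* a := con false) refl a b)
        (solve 3 (λ a b c → con false :* b :+ c :* (con false :* a) := con false) refl a b c)
    }

  -- The product of a θ + b with its conjugate a (θ + 1) + b.
  norm : K² → K
  norm (a , b) = b S.* b S.+ a S.* b S.+ c S.* (a S.* a)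

  -- For a = 0 the norm is b². Otherwise division of a vanishing norm by a² would make b / a a root
  -- of X² + X + c.
  norm≢0 : ∀ x → x ≢ (0# , 0#) → norm x ≢ 0#
  norm≢0 (a , b) x≢0 n≡0 with a S.≟ 0#
  ... | yes refl = x≢0 (cong (0# ,_) ([ id , id ]′ (S.x*y≡0⇒x≡0∨y≡0 b b
    (trans (solve 2 (λ b c → b :* b := b :* b :+ con false :* b :+ c :* (con false :* con false)) refl b c) n≡0))))
  ... | no a≢0 with y , a*y≡1 ← S.inverse a a≢0 = S.X²+X≢c (b S.* y) (S.x+y≡0⇒x≡y _ c (begin
    b S.* y S.* (b S.* y) S.+ b S.* y S.+ c
      ≡⟨ solve 3 (λ b y c → (b :* y) :* (b :* y) :+ b :* y :+ c
                     := (b :* y) :* (b :* y) :+ (b :* y) :* con true :+ c :* (con true :* con true)) refl b y c ⟩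
    b S.* y S.* (b S.* y) S.+ b S.* y S.* 1# S.+ c S.* (1# S.* 1#)
      ≡⟨ cong (λ u → b S.* y S.* (b S.* y) S.+ b S.* y S.* u S.+ c S.* (u S.* u)) a*y≡1 ⟨
    b S.* y S.* (b S.* y) S.+ b S.* y S.* (a S.* y) S.+ c S.* (a S.* y S.* (a S.* y))
      ≡⟨ solve 4 (λ a b y c → (b :* y) :* (b :* y) :+ (b :* y) :* (a :* y) :+ c :* ((a :* y) :* (a :* y))
                     := (b :* b :+ a :* b :+ c :* (a :* a)) :* (y :* y)) refl a b y c ⟩
    norm (a , b) S.* (y S.* y) ≡⟨ cong (S._* (y S.* y)) n≡0 ⟩
    0# S.* (y S.* y)           ≡⟨ S.zeroˡ _ ⟩
    0#                         ∎))
    where open ≡-Reasoning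

  inverse : ∀ x → x ≢ (0# , 0#) → ∃[ y ] x * y ≡ (0# , 1#)
  inverse x@(a , b) x≢0 with v , n*v≡1 ← S.inverse (norm x) (norm≢0 x x≢0) =
    -- The conjugate a θ + (a + b), divided by the norm.
    (a S.* v , (a S.+ b) S.* v) , cong₂ _,_
      (solve 3 (λ a b v → a :* (a :* v) :+ a :* ((a :+ b) :* v) :+ b :* (a :* v) := con false) refl a b v)
      (trans (solve 4 (λ a b v c → b :* ((a :+ b) :* v) :+ c :* (a :* (a :* v))
                           := (b :* b :+ a :* b :+ c :* (a :* a)) :* v) refl a b v c) n*v≡1)

  extension : Field₂
  extension = record
    { isCommutativeSemiring = isCommutativeSemiring
    ; x+x≡0 = λ (a , b) → cong₂ _,_ (S.x+x≡0 a) (S.x+x≡0 b)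
    ; _≟_ = ≡-dec S._≟_ S._≟_
    ; 1≢0 = S.1≢0 ∘ ,-injectiveʳ
    ; inverse = inverse
    }

  -- From here on σ and φ without qualification belong to the extension, with the constant c θ.
  open Frobenius extension (c , 0#)

  -- From θ² = θ + c, n-fold squaring takes θ to θ + φ^n 0, with the old φ; the rest is additivity
  -- and multiplicativity of the Frobenius map.
  σ^ : ∀ n a b → fold (a , b) σ n ≡ (fold a S.σ n , fold a S.σ n S.* fold 0# S.φ n S.+ fold b S.σ n)
  σ^ zero a b = cong (a ,_) (solve 2 (λ a b → b := a :* con false :+ b) refl a b)
  σ^ (suc n) a b = trans (cong σ (σ^ n a b)) (cong₂ _,_
    (solve 2 (λ a b → a :* a :+ a :* b :+ b :* a := a :* a) refl A _)
    (solve 4 (λ a b p c → (a :* p :+ b) :* (a :* p :+ b) :+ c :* (a :* a) := (a :* a) :* (p :* p :+ c) :+ b :* b)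
      refl A (fold b S.σ n) (fold 0# S.φ n) c))
    where
    A = fold a S.σ n

  -- Conjugation over `K`: θ goes to θ + 1 because the old φ^h 0 is 1.
  σ^h : ∀ a b → fold (a , b) σ S.h ≡ (a , a S.+ b)
  σ^h a b = trans (σ^ S.h a b) (cong₂ _,_ (S.σ^h≡id a)
    (trans (cong₂ S._+_ (cong₂ S._*_ (S.σ^h≡id a) S.φ^h[0]≡1) (S.σ^h≡id b)) (cong (S._+ b) (S.*-identityʳ a))))

  -- The coefficient of θ in (a θ + b)² + c θ is a² + c, since the mixed terms cancel.
  proj₁-φ^ : ∀ n x → proj₁ (fold x φ n) ≡ fold (proj₁ x) S.φ n
  proj₁-φ^ zero x = refl
  proj₁-φ^ (suc n) x with fold x φ n | proj₁-φ^ n x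
  ... | a , b | refl = solve 3 (λ a b c → (a :* a :+ a :* b :+ b :* a) :+ c := a :* a :+ c) refl a b c

  θ+x-σ^ : ∀ n x → fold (1# , x) σ n ≡ (1# , fold x S.φ n)
  θ+x-σ^ zero x = refl
  θ+x-σ^ (suc n) x = trans (cong σ (θ+x-σ^ n x)) (cong₂ _,_
    (solve 1 (λ x → con true :* con true :+ con true :* x :+ x :* con true := con true) refl _)
    (solve 2 (λ x c → x :* x :+ c :* (con true :* con true) := x :* x :+ c) refl _ c))

  -- The product (θ + x)(θ + y) equals (1 + x + y) θ + (x y + c), so both pairs have the same sum
  -- and product. Then X = x is a zero of (X + z)(X + w) = X² + (x + y) X + x y.
  θ+x-sidon : ∀ x y z w → (1# , x) * (1# , y) ≡ (1# , z) * (1# , w) → (x ≡ z × y ≡ w) ⊎ (x ≡ w × y ≡ z)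
  θ+x-sidon x y z w eq = [ (λ x+z≡0 → case₁ (S.x+y≡0⇒x≡y x z x+z≡0)) , (λ x+w≡0 → case₂ (S.x+y≡0⇒x≡y x w x+w≡0)) ]′
    (S.x*y≡0⇒x≡0∨y≡0 (x S.+ z) (x S.+ w) (begin
      (x S.+ z) S.* (x S.+ w)
        ≡⟨ solve 4 (λ x z w c → (x :+ z) :* (x :+ w) := x :* (x :+ (z :+ w)) :+ ((z :* w :+ c) :+ c)) refl x z w c ⟩
      x S.* (x S.+ (z S.+ w)) S.+ ((z S.* w S.+ c) S.+ c)
        ≡⟨ cong₂ (λ u v → x S.* (x S.+ u) S.+ (v S.+ c)) sums products ⟨
      x S.* (x S.+ (x S.+ y)) S.+ ((x S.* y S.+ c) S.+ c)
        ≡⟨ solve 3 (λ x y c → x :* (x :+ (x :+ y)) :+ ((x :* y :+ c) :+ c) := con false) refl x y c ⟩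
      0# ∎))
    where
    open ≡-Reasoning
    sums : x S.+ y ≡ z S.+ w
    sums = trans (solve 2 (λ x y → x :+ y := (con true :* con true :+ con true :* y :+ x :* con true) :+ con true) refl x y)
      (trans (cong (S._+ 1#) (,-injectiveˡ eq))
      (solve 2 (λ x y → (con true :* con true :+ con true :* y :+ x :* con true) :+ con true := x :+ y) refl z w))
    products : x S.* y S.+ c ≡ z S.* w S.+ c
    products = trans (solve 3 (λ x y c → x :* y :+ c := x :* y :+ c :* (con true :* con true)) refl x y c)
      (trans (,-injectiveʳ eq) (solve 3 (λ x y c → x :* y :+ c :* (con true :* con true) := x :* y :+ c) refl z w c))
    cancel : ∀ {u v} → x ≡ u → x S.+ y ≡ u S.+ v → y ≡ v
    cancel {u} {v} refl eq = S.+-cancelʳ y v x (trans (S.+-comm y x) (trans eq (S.+-comm x v)))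
    case₁ : x ≡ z → (x ≡ z × y ≡ w) ⊎ (x ≡ w × y ≡ z)
    case₁ x≡z = inj₁ (x≡z , cancel x≡z sums)
    case₂ : x ≡ w → (x ≡ z × y ≡ w) ⊎ (x ≡ w × y ≡ z)
    case₂ x≡w = inj₂ (x≡w , cancel x≡w (trans sums (S.+-comm z w)))

  -- An orbit of the new φ first returns to the fibre over an old representative after one full old
  -- orbit, and this return adds 1. It meets the fibre in a pair b, b + 1, of which the old κ lists
  -- one.
  ρ : Fin (S.r ℕ.* S.e) → K²
  ρ i = let j , l = remQuot S.e i in S.ρ j , S.κ l

  κ : Fin (S.q ℕ.* S.e) → K²
  κ i = let j , l = remQuot S.e i in Inverse.from S.K↔Fin j , S.κ l

  h : ℕ
  h = S.h ℕ.+ S.h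

  σ^2h≡id : ∀ x → fold x σ h ≡ x
  σ^2h≡id (a , b) = trans (fold-+ (a , b) σ S.h)
    (trans (cong (λ x → fold x σ S.h) (σ^h a b)) (trans (σ^h a (a S.+ b))
    (cong (a ,_) (solve 2 (λ a b → a :+ (a :+ b) := b) refl a b))))

  -- With m the old `h`, `w` = φ^m 0 has the form θ + β, as its first coordinate is the old φ^m 0 =
  -- 1. Then φ^(2m) 0 is the conjugate of `w` plus `w`, that is (θ + 1 + β) + (θ + β) = 1.
  φ^2h[0]≡1 : fold (0# , 0#) φ h ≡ (0# , 1#)
  φ^2h[0]≡1 = trans (fold-+ (0# , 0#) φ S.h) (trans (φ^-affine S.h w)
    (trans (cong (_+ w) (trans (cong (λ x → fold x σ S.h) w≡) (σ^h 1# β))) (trans (cong ((1# , 1# S.+ β) +_) w≡)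
    (cong₂ _,_ (S.x+x≡0 1#) (solve 1 (λ β → (con true :+ β) :+ β := con true) refl β)))))
    where
    w = fold (0# , 0#) φ S.h
    β = proj₂ w
    w≡ : w ≡ (1# , β)
    w≡ = cong (_, β) (trans (proj₁-φ^ S.h (0# , 0#)) S.φ^h[0]≡1)

  φ^2h : ∀ x → fold x φ h ≡ x + (0# , 1#)
  φ^2h x = trans (φ^-affine h x) (cong₂ _+_ (σ^2h≡id x) φ^2h[0]≡1)

  remQuot-≡ : ∀ {m} i j → proj₁ (remQuot {m} S.e i) ≡ proj₁ (remQuot {m} S.e j) →
    S.κ (proj₂ (remQuot {m} S.e i)) ≡ S.κ (proj₂ (remQuot {m} S.e j)) → i ≡ j
  remQuot-≡ i j eq₁ eq₂ = remQuot-injective S.e (cong₂ _,_ eq₁ (S.κ-injective eq₂))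

  ρ-orbits : ∀ s i j → s < h ℕ.+ h → fold (ρ i) φ s ≡ ρ j → s ≡ 0 × i ≡ j
  -- The first coordinate reduces s to 0 or 2h (in the old h), and φ^2h = (_+ 1) never maps one κ to another.
  ρ-orbits s i j s<2h eq with s ℕ.<? h
  ... | yes s<h with refl , i₁≡j₁ ← S.ρ-orbits s _ _ s<h (trans (sym (proj₁-φ^ s (ρ i))) (cong proj₁ eq)) =
    refl , remQuot-≡ i j i₁≡j₁ (,-injectiveʳ eq)
  ... | no s≮h with s′ , refl ← ℕ.m≤n⇒∃[o]m+o≡n (ℕ.≮⇒≥ s≮h)
    with refl , i₁≡j₁ ← S.ρ-orbits s′ _ _ (ℕ.+-cancelˡ-< h s′ h s<2h)
      (trans (sym (S.φ^2h≡id _)) (trans (sym (fold-+ (proj₁ (ρ i)) S.φ h)) (trans (sym (proj₁-φ^ (h ℕ.+ s′) (ρ i))) (cong proj₁ eq))))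
    = contradiction (,-injectiveʳ (trans (sym (φ^2h (ρ i))) (trans (sym (fold-+ (ρ i) φ h)) eq)))
        (S.κ+1≢κ _ _)

  next : Stage
  next = record
    { field₂ = extension
    ; c = c , 0#
    -- Comparing coefficients of θ in x² + x = c θ would give a² + a = c in the old field.
    ; X²+X≢c = λ (a , b) eq → S.X²+X≢c a
        (trans (solve 2 (λ a b → a :* a :+ a := (a :* a :+ a :* b :+ b :* a) :+ a) refl a b) (,-injectiveˡ eq))
    ; q = S.q ℕ.* S.q
    ; K↔Fin = ↔-sym Fin.*↔× ↔-∘ (S.K↔Fin ×-↔ S.K↔Fin)
    ; h = h
    ; σ^h≡id = σ^2h≡id
    ; φ^h[0]≡1 = φ^2h[0]≡1
    ; r = S.r ℕ.* S.e
    ; ρ = ρ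
    ; ρ-orbits = ρ-orbits
    ; r*2h≡q = trans
        (r*e*4h≡r*2h*2e S.r S.e S.h)
        (cong₂ ℕ._*_ S.r*2h≡q S.2*e≡q)
    ; e = S.q ℕ.* S.e
    ; κ = κ
    ; κ-injective = λ {i} {j} eq → remQuot-≡ i j
        (Injection.injective (↔⇒↣ (↔-sym S.K↔Fin)) (,-injectiveˡ eq)) (,-injectiveʳ eq)
    ; κ+1≢κ = λ i j eq → S.κ+1≢κ _ _ (,-injectiveʳ eq)
    ; 2*e≡q = trans
        (2*[q*e]≡q*[2*e] S.q S.e)
        (cong (S.q ℕ.*_) S.2*e≡q)
    }

-- The bottom of the tower

𝔽₂ : Field₂
𝔽₂ = record
  { isCommutativeSemiring = CommutativeRing.isCommutativeSemiring Bool.xor-∧-commutativeRing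
  ; x+x≡0 = Bool.xor-same
  ; _≟_ = Bool._≟_
  ; 1≢0 = λ ()
  ; inverse = λ { false 0≢0 → contradiction refl 0≢0 ; true _ → true , refl }
  }

-- Here φ x = x² + 1 = x + 1, so there is a single orbit, of two points, represented by 0.
stage₀ : Stage
stage₀ = record
  { field₂ = 𝔽₂
  ; c = true
  ; X²+X≢c = λ { false () ; true () }
  ; q = 2
  ; K↔Fin = ↔-sym Fin.2↔Bool
  ; h = 1
  ; σ^h≡id = Bool.∧-idem
  ; φ^h[0]≡1 = refl
  ; r = 1
  ; ρ = λ _ → false
  ; ρ-orbits = λ { zero Fin.zero Fin.zero _ _ → refl , refl ; (suc zero) _ _ _ () ; (suc (suc _)) _ _ (s≤s (s≤s ())) _ }
  ; r*2h≡q = refl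
  ; e = 1
  ; κ = λ _ → false
  ; κ-injective = λ { {Fin.zero} {Fin.zero} _ → refl }
  ; κ+1≢κ = λ _ _ ()
  ; 2*e≡q = refl
  }

tower : ℕ → Stage
tower n = fold stage₀ Extension.next n

-- Sparse Sidon sets in ℤ/N

Unique⇒length≤∣p∣ : ∀ {n} (p : Subset n) {xs} → Unique xs → All (_∈ p) xs → length xs ≤ ∣ p ∣
Unique⇒length≤∣p∣ p [] [] = z≤n
Unique⇒length≤∣p∣ p {x ∷ xs} (x∉xs ∷ unique) (x∈p ∷ xs⊆p) = ℕ.≤-trans
  (s≤s (Unique⇒length≤∣p∣ (p - x) unique
    (All.zipWith (λ (y∈p , x≢y) → x∈p∧x≢y⇒x∈p-y y∈p (x≢y ∘ sym)) (xs⊆p , x∉xs))))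
  (x∈p⇒∣p-x∣<∣p∣ x∈p)

injection⇒≤∣p∣ : ∀ {m n} (p : Subset n) (f : Fin m → Fin n) → Injective _≡_ _≡_ f → (∀ i → f i ∈ p) → m ≤ ∣ p ∣
injection⇒≤∣p∣ p f f-injective f∈p = subst (_≤ ∣ p ∣) (length-tabulate f)
  (Unique⇒length≤∣p∣ p (Unique.tabulate⁺ f-injective) (All.tabulate⁺ f∈p))

module _ {n} {P : Fin n → Set} (P? : Decidable P) where
  subset : Subset n
  subset = Vec.tabulate (does ∘ P?)

  ∈subset⁺ : ∀ {i} → P i → i ∈ subset
  ∈subset⁺ {i} Pi = lookup⇒[]= i subset (trans (lookup∘tabulate (does ∘ P?) i) (dec-true (P? i) Pi))

  ∈subset⁻ : ∀ {i} → i ∈ subset → P i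
  ∈subset⁻ {i} i∈ with P? i | trans (sym (lookup∘tabulate (does ∘ P?) i)) ([]=⇒lookup i∈)
  ... | yes Pi | _ = Pi

-- Negative terms change sides, so that both sides are natural numbers and can serve as exponents of
-- a generator.
EqMod⇒∣ : ∀ {N} c c′ (x₁ x₂ x₃ x₄ : Fin N) → EqMod N c c′ x₁ x₂ x₃ x₄ →
  let P = toℕ x₁ ℕ.* c ℕ.+ toℕ x₄ ℕ.* c′ ; M = toℕ x₂ ℕ.* c ℕ.+ toℕ x₃ ℕ.* c′ in
  N ∣ ℤ.∣ P ⊖ M ∣
EqMod⇒∣ {N} c c′ x₁ x₂ x₃ x₄ = subst (λ z → N ∣ ℤ.∣ z ∣) (trans
  (solve 6 (λ c c′ x₁ x₂ x₃ x₄ → c :* (x₁ :- x₂) :- c′ :* (x₃ :- x₄) := (x₁ :* c :+ x₄ :* c′) :- (x₂ :* c :+ x₃ :* c′))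
    refl (ℤ.+ c) (ℤ.+ c′) (ℤ.+ toℕ x₁) (ℤ.+ toℕ x₂) (ℤ.+ toℕ x₃) (ℤ.+ toℕ x₄))
  (trans (cong₂ ℤ._-_ (pos x₁ x₄) (pos x₂ x₃)) (ℤ.m-n≡m⊖n (toℕ x₁ ℕ.* c ℕ.+ toℕ x₄ ℕ.* c′) (toℕ x₂ ℕ.* c ℕ.+ toℕ x₃ ℕ.* c′))))
  where
  open ℤ-Solver.+-*-Solver
  pos : ∀ (x y : Fin N) → ℤ.+ toℕ x ℤ.* ℤ.+ c ℤ.+ ℤ.+ toℕ y ℤ.* ℤ.+ c′ ≡ ℤ.+ (toℕ x ℕ.* c ℕ.+ toℕ y ℕ.* c′)
  pos x y = trans (cong₂ ℤ._+_ (sym (ℤ.pos-* (toℕ x) c)) (sym (ℤ.pos-* (toℕ y) c′))) (sym (ℤ.pos-+ (toℕ x ℕ.* c) _))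

d+ak≡bk⇒d≡0 : ∀ {d} k .{{_ : NonZero k}} → d < k → ∀ a b → d ℕ.+ a ℕ.* k ≡ b ℕ.* k → d ≡ 0 × a ≡ b
d+ak≡bk⇒d≡0 {d} k d<k a b eq
  with refl ← trans (sym (m<n⇒m%n≡m d<k)) (trans (sym ([m+kn]%n≡m%n d a k)) (trans (cong (_% k) eq) (m*n%n≡0 b k)))
  = refl , ℕ.*-cancelʳ-≡ a b k eq

module Construction (S : Stage) (k : ℕ) .{{_ : NonZero k}} where
  private module S = Stage S
  open S using (K; 1#; φ; q; h; r; ρ; φ^-injective)
  open Extension S using (_*_; extension; θ+x-σ^; θ+x-sidon)
  open Field₂ extension using (0#; _≟_; _^_; ^-homo-*; ^-assocʳ; *-identityʳ)
  open Orders extension using (module HasOrder)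
  open Cyclic extension (q ℕ.* q) (Stage.K↔Fin (Extension.next S)) public using (N; N≤Q; g; g-order; g^-injective; log)

  0<k : 0 < k
  0<k = ℕ.n≢0⇒n>0 (ℕ.≢-nonZero⁻¹ k)

  θ+_ : K → K × K
  θ+ x = 1# , x

  logθ : K → Fin N
  logθ x = proj₁ (log (θ+ x) (S.1≢0 ∘ ,-injectiveˡ))

  g^logθ : ∀ x → g ^ toℕ (logθ x) ≡ θ+ x
  g^logθ x = proj₂ (log (θ+ x) (S.1≢0 ∘ ,-injectiveˡ))

  logθ-injective : ∀ {x y} → logθ x ≡ logθ y → x ≡ y
  logθ-injective {x} {y} eq = ,-injectiveʳ (trans (sym (g^logθ x)) (trans (cong (λ a → g ^ toℕ a) eq) (g^logθ y)))

  q≤N : q ≤ N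
  q≤N = Fin.injective⇒≤ (Injection.injective (↔⇒↣ (↔-sym S.K↔Fin)) ∘ logθ-injective)

  -- Injectivity of φ cancels the smaller exponent and leaves `ρ-orbits` for the difference.
  orbit-unique : ∀ a b i j → a < h ℕ.+ h → b < h ℕ.+ h → fold (ρ i) φ a ≡ fold (ρ j) φ b → a ≡ b × i ≡ j
  orbit-unique a b i j a< b< eq =
    [ (λ a≤b → le i j b< a≤b eq) , (λ b≤a → let b≡a , j≡i = le j i a< b≤a (sym eq) in sym b≡a , sym j≡i) ]′ (ℕ.≤-total a b)
    where
    le : ∀ {a b} i j → b < h ℕ.+ h → a ≤ b → fold (ρ i) φ a ≡ fold (ρ j) φ b → a ≡ b × i ≡ j
    le {a} i j b< a≤b eq with d , refl ← ℕ.m≤n⇒∃[o]m+o≡n a≤b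
      with d≡0 , j≡i ← S.ρ-orbits d j i (ℕ.≤-<-trans (ℕ.m≤n+m d a) b<)
                         (φ^-injective a (trans (sym (fold-+ (ρ j) φ a)) (sym eq)))
      = trans (sym (ℕ.+-identityʳ a)) (cong (a ℕ.+_) (sym d≡0)) , sym j≡i

  -- Rounding down drops an incomplete last block, so the last chosen point is also at least `k`
  -- steps before the first one around the orbit.
  t : ℕ
  t = (h ℕ.+ h) / k

  -- Every k-th point of each orbit of φ (an orbit has h + h points).
  τ : Fin (t ℕ.* r) → K
  τ i = let j , l = remQuot {t} r i in fold (ρ l) φ (toℕ j ℕ.* k)

  -- Fewer than `k` further steps from a chosen point do not complete the orbit, so positions can be
  -- compared without wrapping; modulo `k` they give d = 0.
  τ-sparse : ∀ {d} → d < k → ∀ i j → fold (τ i) φ d ≡ τ j → d ≡ 0 × i ≡ j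
  τ-sparse {d} d<k i j eq =
    proj₁ steps , remQuot-injective {t} r (cong₂ _,_ (Fin.toℕ-injective (proj₂ steps)) (proj₂ orbits))
    where
    i₁ = proj₁ (remQuot {t} r i)
    j₁ = proj₁ (remQuot {t} r j)

    bound : ∀ {d} → d < k → (i : Fin t) → d ℕ.+ toℕ i ℕ.* k < h ℕ.+ h
    bound {d} d<k i = ℕ.≤-trans (ℕ.+-monoˡ-< (toℕ i ℕ.* k) d<k)
      (ℕ.≤-trans (ℕ.*-monoˡ-≤ k (Fin.toℕ<n i)) (m/n*n≤m (h ℕ.+ h) k))

    orbits = orbit-unique (d ℕ.+ toℕ i₁ ℕ.* k) (toℕ j₁ ℕ.* k) (proj₂ (remQuot {t} r i)) (proj₂ (remQuot {t} r j))
      (bound d<k i₁) (bound 0<k j₁) (trans (fold-+ (ρ _) φ d) eq)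

    steps = d+ak≡bk⇒d≡0 k d<k (toℕ i₁) (toℕ j₁) (proj₁ orbits)

  private
    InA : Fin N → Set
    InA a = ∃[ i ] g ^ toℕ a ≡ θ+ τ i

    InA? : Decidable InA
    InA? a = Fin.any? (λ i → (g ^ toℕ a) ≟ (θ+ τ i))

  A : Subset N
  A = subset InA?

  t*r≤∣A∣ : t ℕ.* r ≤ ∣ A ∣
  t*r≤∣A∣ = injection⇒≤∣p∣ A (logθ ∘ τ)
    (λ {i} {j} eq → proj₂ (τ-sparse 0<k i j (logθ-injective eq)))
    (λ i → ∈subset⁺ InA? (i , g^logθ (τ i)))

  ^2^ : ∀ x n → x ^ (2 ℕ.^ n) ≡ fold x (λ y → y * y) n
  ^2^ x zero = *-identityʳ x
  ^2^ x (suc n) = trans (cong (x ^_) (cong (2 ℕ.^ n ℕ.+_) (ℕ.+-identityʳ (2 ℕ.^ n))))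
    (trans (^-homo-* x (2 ℕ.^ n) (2 ℕ.^ n)) (cong (λ y → y * y) (^2^ x n)))

  g^*2^ : ∀ a {x} n → g ^ a ≡ θ+ x → g ^ (a ℕ.* 2 ℕ.^ n) ≡ θ+ fold x φ n
  g^*2^ a {x} n eq = trans (sym (^-assocʳ g a (2 ℕ.^ n)))
    (trans (cong (_^ (2 ℕ.^ n)) eq) (trans (^2^ (θ+ x) n) (θ+x-σ^ n x)))

  g^-cong-∣ : ∀ a b → N ∣ ℤ.∣ a ⊖ b ∣ → g ^ a ≡ g ^ b
  g^-cong-∣ a b N∣ = [ (λ a≤b → le a≤b (subst (N ∣_) (ℤ.∣⊖∣-≤ a≤b) N∣))
                     , (λ b≤a → sym (le b≤a (subst (N ∣_) (trans (ℤ.∣m⊖n∣≡∣n⊖m∣ a b) (ℤ.∣⊖∣-≤ b≤a)) N∣))) ]′ (ℕ.≤-total a b)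
    where
    le : ∀ {a b} → a ≤ b → N ∣ b ∸ a → g ^ a ≡ g ^ b
    le {a} {b} a≤b N∣ = sym (trans (cong (g ^_) (sym (ℕ.m+[n∸m]≡n a≤b))) (trans (^-homo-* g a (b ∸ a))
      (trans (cong (g ^ a *_) (HasOrder.∣⇒^≡1 g-order N∣)) (*-identityʳ _))))

  -- As exponents of `g`, the two sides give equal products of two elements θ + x. The Sidon
  -- property leaves two ways to match the factors, and these become the two kinds of trivial
  -- solution.
  onlyTrivial : (i j : Fin k) → i ≤ᶠ j → OnlyTrivial (λ i → 2 ℕ.^ toℕ i) N A i j
  onlyTrivial i j i≤j x₁ x₂ x₃ x₄ x₁∈ x₂∈ x₃∈ x₄∈ eq
    with l₁ , e₁ ← ∈subset⁻ InA? x₁∈ | l₂ , e₂ ← ∈subset⁻ InA? x₂∈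
       | l₃ , e₃ ← ∈subset⁻ InA? x₃∈ | l₄ , e₄ ← ∈subset⁻ InA? x₄∈
    = conclude (θ+x-sidon _ _ _ _ (begin
        (θ+ fold (τ l₁) φ m) * (θ+ fold (τ l₄) φ n)
          ≡⟨ cong₂ _*_ (g^*2^ (toℕ x₁) m e₁) (g^*2^ (toℕ x₄) n e₄) ⟨
        g ^ (toℕ x₁ ℕ.* 2 ℕ.^ m) * g ^ (toℕ x₄ ℕ.* 2 ℕ.^ n)
          ≡⟨ ^-homo-* g (toℕ x₁ ℕ.* 2 ℕ.^ m) (toℕ x₄ ℕ.* 2 ℕ.^ n) ⟨
        g ^ (toℕ x₁ ℕ.* 2 ℕ.^ m ℕ.+ toℕ x₄ ℕ.* 2 ℕ.^ n)
          ≡⟨ g^-cong-∣ (toℕ x₁ ℕ.* 2 ℕ.^ m ℕ.+ toℕ x₄ ℕ.* 2 ℕ.^ n) (toℕ x₂ ℕ.* 2 ℕ.^ m ℕ.+ toℕ x₃ ℕ.* 2 ℕ.^ n)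
               (EqMod⇒∣ (2 ℕ.^ m) (2 ℕ.^ n) x₁ x₂ x₃ x₄ eq) ⟩
        g ^ (toℕ x₂ ℕ.* 2 ℕ.^ m ℕ.+ toℕ x₃ ℕ.* 2 ℕ.^ n)
          ≡⟨ ^-homo-* g (toℕ x₂ ℕ.* 2 ℕ.^ m) (toℕ x₃ ℕ.* 2 ℕ.^ n) ⟩
        g ^ (toℕ x₂ ℕ.* 2 ℕ.^ m) * g ^ (toℕ x₃ ℕ.* 2 ℕ.^ n)
          ≡⟨ cong₂ _*_ (g^*2^ (toℕ x₂) m e₂) (g^*2^ (toℕ x₃) n e₃) ⟩
        (θ+ fold (τ l₂) φ m) * (θ+ fold (τ l₃) φ n) ∎))
    where
    open ≡-Reasoning
    m = toℕ i
    n = toℕ j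

    θ⇒x : ∀ {x y u v} → g ^ toℕ x ≡ θ+ u → g ^ toℕ y ≡ θ+ v → u ≡ v → x ≡ y
    θ⇒x e e′ u≡v = g^-injective (trans e (trans (cong θ+_ u≡v) (sym e′)))

    conclude : (fold (τ l₁) φ m ≡ fold (τ l₂) φ m × fold (τ l₄) φ n ≡ fold (τ l₃) φ n)
             ⊎ (fold (τ l₁) φ m ≡ fold (τ l₃) φ n × fold (τ l₄) φ n ≡ fold (τ l₂) φ m) → Trivial i j x₁ x₂ x₃ x₄
    conclude (inj₁ (eq₁ , eq₂)) = inj₁ (θ⇒x e₁ e₂ (φ^-injective m eq₁) , θ⇒x e₃ e₄ (φ^-injective n (sym eq₂)))
    -- Cancelling φ^m places `τ l₁` exactly d = n - m < k steps after `τ l₃`, so sparsity forces d =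
    -- 0, whence i = j.
    conclude (inj₂ (eq₁ , eq₂)) with d , m+d≡n ← ℕ.m≤n⇒∃[o]m+o≡n i≤j
      with refl , _ ← τ-sparse (ℕ.≤-<-trans (subst (d ≤_) m+d≡n (ℕ.m≤n+m d m)) (Fin.toℕ<n j)) l₃ l₁
             (sym (φ^-injective m (trans eq₁ (trans (cong (fold (τ l₃) φ) (sym m+d≡n)) (fold-+ (τ l₃) φ m)))))
      with refl ← Fin.toℕ-injective (trans (sym (ℕ.+-identityʳ m)) m+d≡n)
      = inj₂ (refl , θ⇒x e₁ e₃ (φ^-injective m eq₁) , θ⇒x e₂ e₄ (φ^-injective m (sym eq₂)))

-- The family along the tower

-- A family given along the values of f extends to all N, because n ≤ f n makes the search for a preimage of N finite.
module Reindex {B : ℕ → Set} (default : ∀ N → B N) {f : ℕ → ℕ} (n≤f : ∀ n → n ≤ f n) (b : ∀ n → B (f n)) where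
  extend : ∀ N → B N
  extend N with Fin.any? {n = suc N} (λ i → f (toℕ i) ℕ.≟ N)
  ... | yes (i , eq) = subst B eq (b (toℕ i))
  ... | no _ = default N

  -- The search may find a preimage other than the given one, so the property is required at every
  -- preimage.
  extend-elim : (P : ∀ N → B N → Set) → ∀ N → ∃[ n ] f n ≡ N → (∀ n → f n ≡ N → P (f n) (b n)) → P N (extend N)
  extend-elim P N (n , fn≡N) p with Fin.any? {n = suc N} (λ i → f (toℕ i) ℕ.≟ N)
  ... | yes (i , eq) = transport (toℕ i) eq (p (toℕ i) eq)
    where
    transport : ∀ n (eq : f n ≡ N) → P (f n) (b n) → P N (subst B eq (b n))
    transport n refl pn = pn
  ... | no missing = contradiction (fromℕ< n<1+N , trans (cong f (Fin.toℕ-fromℕ< n<1+N)) fn≡N) missing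
    where
    n<1+N = s≤s (subst (n ≤_) fn≡N (n≤f n))

-- Growth and density estimates

n<h : ∀ n → n < Stage.h (tower n)
n<h zero = s≤s z≤n
n<h (suc n) = ℕ.+-mono-≤ (ℕ.≤-trans (s≤s z≤n) (n<h n)) (n<h n)

2+n≤q : ∀ n → 2 ℕ.+ n ≤ Stage.q (tower n)
2+n≤q zero = ℕ.≤-refl
2+n≤q (suc n) = ℕ.≤-trans
  (ℕ.≤-trans (ℕ.≤-reflexive (ℕ.+-comm 1 (2 ℕ.+ n))) (ℕ.+-monoʳ-≤ (2 ℕ.+ n) (s≤s z≤n)))
  (ℕ.*-mono-≤ (2+n≤q n) (2+n≤q n))

q-mono-≤ : ∀ {m n} → m ≤ n → Stage.q (tower m) ≤ Stage.q (tower n)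
q-mono-≤ = mono ∘ ℕ.≤⇒≤′
  where
  mono : ∀ {m n} → m ℕ.≤′ n → Stage.q (tower m) ≤ Stage.q (tower n)
  mono ℕ.≤′-refl = ℕ.≤-refl
  mono {n = suc n} (ℕ.≤′-step m≤n) = ℕ.≤-trans (mono m≤n)
    (ℕ.m≤m*n (Stage.q (tower n)) (Stage.q (tower n)) {{ℕ.>-nonZero (ℕ.≤-trans (s≤s z≤n) (2+n≤q n))}})

-- Rounding `l` down to a multiple of `k` loses at most k ≤ l / (m + 1). Adding `l` to both sides
-- avoids subtraction.
density : ∀ m k .{{_ : NonZero k}} l → suc m ℕ.* k ≤ l → m ℕ.* l ≤ suc m ℕ.* (l / k ℕ.* k)
density m k l mk≤l = ℕ.+-cancelˡ-≤ l _ _ (begin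
  suc m ℕ.* l                                    ≡⟨ cong (suc m ℕ.*_) (m≡m%n+[m/n]*n l k) ⟩
  suc m ℕ.* (l % k ℕ.+ l / k ℕ.* k)              ≡⟨ ℕ.*-distribˡ-+ (suc m) (l % k) _ ⟩
  suc m ℕ.* (l % k) ℕ.+ suc m ℕ.* (l / k ℕ.* k)  ≤⟨ ℕ.+-monoˡ-≤ _ (ℕ.*-monoʳ-≤ (suc m) (m%n≤n l k)) ⟩
  suc m ℕ.* k ℕ.+ suc m ℕ.* (l / k ℕ.* k)        ≤⟨ ℕ.+-monoˡ-≤ _ mk≤l ⟩
  l ℕ.+ suc m ℕ.* (l / k ℕ.* k)                  ∎)
  where open ℕ.≤-Reasoning

square-bound : ∀ {k m m′ N q a} → N ≤ q ℕ.* q → m ℕ.* q ≤ k ℕ.* m′ ℕ.* a →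
  m ℕ.* m ℕ.* N ≤ k ℕ.* k ℕ.* (m′ ℕ.* m′) ℕ.* (a ℕ.* a)
square-bound {k} {m} {m′} {N} {q} {a} N≤q² bound = begin
  m ℕ.* m ℕ.* N                                ≤⟨ ℕ.*-monoʳ-≤ (m ℕ.* m) N≤q² ⟩
  m ℕ.* m ℕ.* (q ℕ.* q)                        ≡⟨ solve 2 (λ m q → m :* m :* (q :* q) := m :* q :* (m :* q)) refl m q ⟩
  m ℕ.* q ℕ.* (m ℕ.* q)                        ≤⟨ ℕ.*-mono-≤ bound bound ⟩
  k ℕ.* m′ ℕ.* a ℕ.* (k ℕ.* m′ ℕ.* a)          ≡⟨ solve 3 (λ k m a → k :* m :* a :* (k :* m :* a)
                                                     := k :* k :* (m :* m) :* (a :* a)) refl k m′ a ⟩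
  k ℕ.* k ℕ.* (m′ ℕ.* m′) ℕ.* (a ℕ.* a)        ∎
  where
  open ℕ.≤-Reasoning
  open +-*-Solver

module Family (k : ℕ) .{{k≢0 : NonZero k}} where
  private module C n = Construction (tower n) k {{k≢0}}

  n≤N : ∀ n → n ≤ C.N n
  n≤N n = ℕ.≤-trans (ℕ.m≤n+m n 2) (ℕ.≤-trans (2+n≤q n) (C.q≤N n))

  -- At least t r of the q = r (h + h) points are chosen, and t k is close to h + h, so the set has
  -- about q / k elements, where q is at least the square root of the modulus.
  A-dense : ∀ m n → suc m ℕ.* k ≤ n →
    m ℕ.* m ℕ.* C.N n ≤ k ℕ.* k ℕ.* (suc m ℕ.* suc m) ℕ.* (∣ C.A n ∣ ℕ.* ∣ C.A n ∣)
  A-dense m n mk≤n = square-bound {k} {m} (C.N≤Q n) (begin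
    m ℕ.* q                            ≡⟨ cong (m ℕ.*_) r*2h≡q ⟨
    m ℕ.* (r ℕ.* (h ℕ.+ h))            ≡⟨ solve 3 (λ m r l → m :* (r :* l) := r :* (m :* l)) refl m r (h ℕ.+ h) ⟩
    r ℕ.* (m ℕ.* (h ℕ.+ h))            ≤⟨ ℕ.*-monoʳ-≤ r (density m k (h ℕ.+ h)
                                            (ℕ.≤-trans mk≤n (ℕ.≤-trans (ℕ.<⇒≤ (n<h n)) (ℕ.m≤m+n h h)))) ⟩
    r ℕ.* (suc m ℕ.* (C.t n ℕ.* k))    ≡⟨ solve 4 (λ r m t k → r :* (m :* (t :* k)) := k :* m :* (t :* r))
                                            refl r (suc m) (C.t n) k ⟩
    k ℕ.* suc m ℕ.* (C.t n ℕ.* r)      ≤⟨ ℕ.*-monoʳ-≤ (k ℕ.* suc m) (C.t*r≤∣A∣ n) ⟩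
    k ℕ.* suc m ℕ.* ∣ C.A n ∣          ∎)
    where
    open Stage (tower n) using (q; r; h; r*2h≡q)
    open ℕ.≤-Reasoning
    open +-*-Solver

  -- Turns a threshold on the modulus into one on the stage: the modulus of stage `n` is at most q²,
  -- and q grows along the tower.
  N-large : ∀ m n → suc (Stage.q (tower m) ℕ.* Stage.q (tower m)) ≤ C.N n → m ≤ n
  N-large m n M≤N = ℕ.≮⇒≥ (λ n<m → ℕ.<⇒≱ M≤N (ℕ.≤-trans (C.N≤Q n)
    (ℕ.*-mono-≤ (q-mono-≤ (ℕ.<⇒≤ n<m)) (q-mono-≤ (ℕ.<⇒≤ n<m)))))

  𝒩 : ℕ → Set
  𝒩 N = ∃[ n ] C.N n ≡ N

  open Reindex {Subset} (λ _ → ⊥) {C.N} n≤N C.A using (extend-elim) renaming (extend to A) public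

  𝒩-positive : ∀ N → 𝒩 N → 0 < N
  𝒩-positive _ (n , refl) = ℕ.≤-trans (ℕ.≤-trans (s≤s z≤n) (2+n≤q n)) (C.q≤N n)

  𝒩-infinite : Infinite 𝒩
  𝒩-infinite M = C.N M , n≤N M , M , refl

  lowerBound : LowerBound k 𝒩 A
  -- For ε = 1 / (m + 1) the density estimate holds from stage b = (m + 1) k on; a modulus above the
  -- square of q at stage `b` comes from such a stage.
  lowerBound (suc m) _ = suc (Stage.q (tower b) ℕ.* Stage.q (tower b)) , λ N M≤N N∈𝒩 →
    extend-elim (λ N A → m ℕ.* m ℕ.* N ≤ k ℕ.* k ℕ.* (suc m ℕ.* suc m) ℕ.* (∣ A ∣ ℕ.* ∣ A ∣)) N N∈𝒩
      (λ { n refl → A-dense m n (N-large b n M≤N) })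
    where
    b = suc m ℕ.* k

  onlyTrivial : ∀ N → 𝒩 N → (i j : Fin k) → i ≤ᶠ j → OnlyTrivial (λ i → 2 ℕ.^ toℕ i) N (A N) i j
  onlyTrivial N N∈𝒩 i j i≤j =
    extend-elim (λ N A → OnlyTrivial (λ i → 2 ℕ.^ toℕ i) N A i j) N N∈𝒩 (λ n _ → C.onlyTrivial n i j i≤j)

2^-injective : Injective _≡_ _≡_ (2 ℕ.^_)
2^-injective {a} {b} eq with ℕ.<-cmp a b
... | tri< a<b _ _ = contradiction eq (ℕ.<⇒≢ (ℕ.^-monoʳ-< 2 ℕ.≤-refl a<b))
... | tri≈ _ a≡b _ = a≡b
... | tri> _ _ b<a = contradiction (sym eq) (ℕ.<⇒≢ (ℕ.^-monoʳ-< 2 ℕ.≤-refl b<a))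

theorem1p4 : (k : ℕ) → 2 ≤ k →
    Σ[ c ∈ (Fin k → ℕ) ] Σ[ 𝒩 ∈ (ℕ → Set) ] Σ[ A ∈ ((N : ℕ) → Subset N) ]
    ( Injective _≡_ _≡_ c
    × (∀ i → 0 < c i)
    × (∀ N → 𝒩 N → 0 < N)
    × Infinite 𝒩
    × LowerBound k 𝒩 A
    × (∀ N → 𝒩 N → (i j : Fin k) → i ≤ᶠ j → OnlyTrivial c N (A N) i j) )
theorem1p4 k@(suc _) _ =
  (λ i → 2 ℕ.^ toℕ i) , 𝒩 , A ,
  Fin.toℕ-injective ∘ 2^-injective ,
  (λ i → ℕ.m^n>0 2 (toℕ i)) ,
  𝒩-positive , 𝒩-infinite , lowerBound , onlyTrivial
  where open Family k
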